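{- Let $k\ge 0$ be an integer and let $(X,\delta)$ be a finite metric space that admits a $k$-dimensional control function $f$ with $f(x)\le c\cdot x$ for all $x>0$, for some positive constant $c$. Then $(X,\delta)$ has a tree cover of size $k+1$ and stretch $12(3c+2)^2$.
   Context: Let $(X,\delta)$ be a metric space. $r$-components: for $Y\subseteq X$ and $r>0$, two points $u,v\in Y$ are $r$-connected in $Y$ if there is a finite sequence $u=y_0,y_1,\dots,y_m=v$ of points of $Y$ with $\delta(y_{i-1},y_i)\le r$ for all $i$. This is an equivalence relation on $Y$; its equivalence classes are the $r$-components of $Y$. Control function: a $k$-dimensional control function of $(X,\delta)$ is a function $f:\mathbb{R}^+\to\mathbb{R}^+$ such that for every $r>0$ there exist subsets $U_1,\dots,U_{k+1}$ of $X$ with $\bigcup_{i=1}^{k+1}U_i=X$ and such that, for every $i\in\{1,\dots,k+1\}$, each $r$-component $U$ of $U_i$ has diameter at most $f(r)$, i.e. $\delta(u,v)\le f(r)$ for all $u,v\in U$. Tree cover: a tree cover of $(X,\delta)$ of size $l$ and stretch $\sigma$ is a collection $\mathcal{T}=\{T_1,\dots,T_l\}$ of $l$ trees (an indexed family) with nonnegative edge weights, each of which has a vertex set containing $X$ (extra vertices not in $X$ are allowed), such that, writing $d_T$ for the weighted shortest-path distance in a tree $T$: (1) for every $i\in\{1,\dots,l\}$ and all $u,v\in X$, $d_{T_i}(u,v)\ge \delta(u,v)$; (2) for all $u,v\in X$ there exists $j\in\{1,\dots,l\}$ with $d_{T_j}(u,v)\le \sigma\cdot\delta(u,v)$. -}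

module Defs where

open import Algebra.Bundles using (CommutativeRing; Semiring)
import Algebra.Definitions.RawSemiring as RawSemiringDefinitions
open import Data.Fin.Base using (Fin)
open import Data.List.Base using (List; []; _∷_)
open import Data.List.Relation.Unary.Unique.Propositional using (Unique)
open import Data.Nat.Base using (ℕ; suc) renaming (_≤_ to _≤ᴺ_)
open import Data.Product.Base using (∃-syntax; Σ-syntax; _×_; proj₁)
open import Function.Bundles using (_↔_; _↣_; Injection)
open import Function.Metric.Structures using (IsGeneralMetric)
open import Level using (0ℓ)
open import Relation.Binary.Core using (Rel)
import Relation.Binary.Construct.NonStrictToStrict as NonStrictToStrict
open import Relation.Binary.Construct.Closure.ReflexiveTransitive using (Star)
open import Relation.Binary.PropositionalEquality using (_≡_)
open import Relation.Binary.Structures using (IsTotalOrder)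
open import Relation.Nullary.Negation using (¬_)
open import Relation.Unary using (Pred; Satisfiable; _∈_)

Finite : Set → Set
Finite A = ∃[ n ] (A ↔ Fin n)

-- The real numbers, given axiomatically as a Dedekind-complete ordered field;
-- classically this determines them up to unique isomorphism.
record Reals : Set₁ where
  field
    commutativeRing : CommutativeRing 0ℓ 0ℓ

  open CommutativeRing commutativeRing public renaming (Carrier to ℝ)

  infix 4 _≤_
  field
    _≤_          : Rel ℝ 0ℓ
    isTotalOrder : IsTotalOrder _≈_ _≤_
    0≉1          : ¬ (0# ≈ 1#)
    inverse      : ∀ x → ¬ (x ≈ 0#) → ∃[ y ] (x * y ≈ 1#)
    +-monoˡ-≤    : ∀ {x y} z → x ≤ y → x + z ≤ y + z
    *-nonNeg     : ∀ {x y} → 0# ≤ x → 0# ≤ y → 0# ≤ x * y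

  UpperBound : Pred ℝ 0ℓ → Pred ℝ 0ℓ
  UpperBound S b = ∀ {x} → x ∈ S → x ≤ b

  field
    complete : (S : Pred ℝ 0ℓ) → Satisfiable S → Satisfiable (UpperBound S) →
               ∃[ s ] (s ∈ UpperBound S × (∀ {b} → b ∈ UpperBound S → s ≤ b))

  open NonStrictToStrict _≈_ _≤_ public using (_<_)
  open RawSemiringDefinitions (Semiring.rawSemiring semiring) public using (_^_)
  open RawSemiringDefinitions (Semiring.rawSemiring semiring) using () renaming (_×_ to _·_)

  fromℕ : ℕ → ℝ
  fromℕ n = n · 1#

  ℝ⁺ : Set
  ℝ⁺ = ∃[ x ] (0# < x)

record MetricSpace (R : Reals) : Set₁ where
  open Reals R
  field
    X        : Set
    δ        : X → X → ℝ
    isMetric : IsGeneralMetric _≡_ _≈_ _≤_ 0# _+_ δ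

module _ {R : Reals} (M : MetricSpace R) where
  open Reals R
  open MetricSpace M

  Step : Pred X 0ℓ → ℝ → Rel X 0ℓ
  Step Y r u v = u ∈ Y × v ∈ Y × δ u v ≤ r

  -- Only meaningful for endpoints in Y: the empty sequence of steps connects
  -- every point of X to itself.
  Connected : Pred X 0ℓ → ℝ → Rel X 0ℓ
  Connected Y r = Star (Step Y r)

  -- The r-component of Y through a point u of Y.
  Component : Pred X 0ℓ → ℝ → X → Pred X 0ℓ
  Component Y r u v = v ∈ Y × Connected Y r u v

  DiameterAtMost : ℝ → Pred X 0ℓ → Set
  DiameterAtMost d C = ∀ {u v} → u ∈ C → v ∈ C → δ u v ≤ d

  record IsControlFunction (k : ℕ) (f : ℝ⁺ → ℝ⁺) : Set₁ where
    field
      -- f is a function on ℝ⁺ taken modulo the equality _≈_ of reals.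
      cong    : ∀ x y → proj₁ x ≈ proj₁ y → proj₁ (f x) ≈ proj₁ (f y)
      control : ∀ (r : ℝ⁺) → Σ[ U ∈ (Fin (suc k) → Pred X 0ℓ) ]
                  ((∀ x → ∃[ i ] (x ∈ U i)) ×
                   (∀ i u → u ∈ U i →
                     DiameterAtMost (proj₁ (f r)) (Component (U i) (proj₁ r) u)))

module _ {V : Set} (Adj : Rel V 0ℓ) where

  data Walk : Rel V 0ℓ where
    []  : ∀ {u} → Walk u u
    _∷_ : ∀ {u v w} → Adj u v → Walk v w → Walk u w

module _ {V : Set} {Adj : Rel V 0ℓ} where

  length : ∀ {u v} → Walk Adj u v → ℕ
  length []      = 0
  length (_ ∷ p) = suc (length p)

  vertices : ∀ {u v} → Walk Adj u v → List V
  vertices {u} []      = u ∷ []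
  vertices {u} (_ ∷ p) = u ∷ vertices p

  IsPath : ∀ {u v} → Walk Adj u v → Set
  IsPath p = Unique (vertices p)

-- A finite nonempty simple graph that is connected and acyclic, with
-- nonnegative edge weights.
record WeightedTree (R : Reals) : Set₁ where
  open Reals R
  field
    V         : Set
    finite    : Finite V
    nonempty  : V
    Adj       : Rel V 0ℓ
    adj-sym   : ∀ {u v} → Adj u v → Adj v u
    loopless  : ∀ {u} → ¬ Adj u u
    connected : ∀ u v → Walk Adj u v
    -- A cycle is a path with at least two edges, closed up by one more edge.
    acyclic   : ∀ {u v} → Adj u v → (p : Walk Adj v u) → IsPath p →
                ¬ (2 ≤ᴺ length p)
    -- The values of weight at non-adjacent pairs are irrelevant.
    weight        : V → V → ℝ
    weight-sym    : ∀ {u v} → Adj u v → weight u v ≈ weight v u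
    weight-nonNeg : ∀ {u v} → Adj u v → 0# ≤ weight u v

  totalWeight : ∀ {u v} → Walk Adj u v → ℝ
  totalWeight []                  = 0#
  totalWeight (_∷_ {u} {v} _ p) = weight u v + totalWeight p

  -- d u v is the minimum weight of a walk from u to v.
  IsShortestPathDistance : (V → V → ℝ) → Set
  IsShortestPathDistance d = ∀ u v →
    (∃[ p ] (totalWeight {u} {v} p ≈ d u v)) ×
    (∀ (p : Walk Adj u v) → d u v ≤ totalWeight p)

record TreeCover {R : Reals} (M : MetricSpace R) (l : ℕ) (σ : Reals.ℝ R) : Set₁ where
  open Reals R
  open MetricSpace M
  field
    tree : Fin l → WeightedTree R

  module T (i : Fin l) = WeightedTree (tree i)

  field
    embed  : ∀ i → X ↣ T.V i
    dist   : ∀ i → T.V i → T.V i → ℝ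
    isDist : ∀ i → T.IsShortestPathDistance i (dist i)

  distX : Fin l → X → X → ℝ
  distX i u v = dist i (Injection.to (embed i) u) (Injection.to (embed i) v)

  field
    dominating : ∀ i u v → δ u v ≤ distX i u v
    stretch    : ∀ u v → ∃[ j ] (distX j u v ≤ σ * δ u v)

{-# OPTIONS --safe #-}

-- Take scales r₀ ≤ min δ and rⱼ₊₁ = ρ rⱼ, with ρ = 3c + 4, and fix one of the
-- k + 1 colours. The rⱼ-neighbourhoods of the 3rⱼ-components of that colour at
-- level j are pairwise more than rⱼ apart. Merging at level j all classes of
-- level j - 1 that meet a common neighbourhood therefore gives again an
-- equivalence relation: a class of level j - 1 has diameter at most rⱼ, hence
-- meets at most one neighbourhood, and the merged classes have diameter at most
-- (3c + 2) rⱼ + 2 rⱼ = rⱼ₊₁. Joining the centre of every class to the centre of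
-- the next larger class yields a tree on X whose edge weights δ dominate δ. As
-- the radii grow at least by the factor 3, two points in one class of level j
-- are at tree distance at most 3 rⱼ₊₁. If rⱼ ≤ δ u v ≤ rⱼ₊₁, then u and v are
-- in one class of level j + 1 for any colour containing u, so their distance is
-- at most 3 ρ² rⱼ ≤ 12 (3c + 2)² δ u v.
module Submission where

open import Defs
open import Axiom.ExcludedMiddle using (ExcludedMiddle)
open import Data.Nat.Base using (ℕ; zero; suc)
open import Data.Product.Base using (proj₁)
open import Level using (0ℓ)

open import Algebra.Bundles using (CommutativeRing)
import Algebra.Properties.Ring as RingProperties
import Algebra.Solver.Ring.NaturalCoefficients.Default as NaturalCoefficients
open import Data.Fin.Base using (Fin; toℕ)
import Data.Fin.Base as Fin
open import Data.Fin.Properties using (1↔⊤; toℕ-injective)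
open import Data.List.Membership.Propositional using () renaming (_∈_ to _∈ˡ_)
import Data.List.Relation.Unary.All as All
open import Data.List.Relation.Unary.AllPairs using ([]; _∷_)
open import Data.List.Relation.Unary.Any using (here; there)
import Data.Nat.Base as ℕ
open import Data.Nat.Induction using (<-wellFounded)
import Data.Nat.Properties as ℕ
open import Data.Product.Base using (∃-syntax; _×_; _,_; proj₂; swap)
open import Data.Sum.Base using (_⊎_; inj₁; inj₂)
import Data.Sum.Base as Sum
open import Data.Unit.Base using (⊤; tt)
open import Function.Bundles using (Injection; Inverse; mk↣)
open import Function.Construct.Identity using (↣-id)
open import Function.Metric.Structures using (IsGeneralMetric)
open import Function.Properties.Inverse using (↔⇒↣; ↔-sym)
open import Induction.WellFounded using (Acc; acc)
open import Relation.Binary.Bundles using (Poset)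
open import Relation.Binary.Construct.Closure.ReflexiveTransitive using (ε; _◅_; _◅◅_; reverse)
open import Relation.Binary.Core using (Rel)
open import Relation.Binary.Definitions using (tri<; tri≈; tri>)
open import Relation.Binary.PropositionalEquality using (_≡_; _≢_)
import Relation.Binary.PropositionalEquality as ≡
import Relation.Binary.Reasoning.PartialOrder as PartialOrderReasoning
open import Relation.Binary.Structures using (IsTotalOrder)
open import Relation.Nullary.Decidable using (Dec; yes; no)
open import Relation.Nullary.Negation using (¬_; contradiction)
open import Relation.Unary using (Pred; _∈_)

-- Ordered-field arithmetic and the Archimedean property.

module RealProperties (R : Reals) where
  open Reals R
  open RingProperties (CommutativeRing.ring commutativeRing)
    using (-‿distribˡ-*; -‿involutive)
  open IsTotalOrder isTotalOrder public
    using (total; antisym; ≤-respˡ-≈; ≤-respʳ-≈)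
    renaming (refl to ≤-refl; trans to ≤-trans; reflexive to ≤-reflexive)

  poset : Poset 0ℓ 0ℓ 0ℓ
  poset = record { isPartialOrder = IsTotalOrder.isPartialOrder isTotalOrder }

  open PartialOrderReasoning poset public
  open NaturalCoefficients commutativeSemiring public
    using (solve; _:=_; _:+_; _:*_; con; Polynomial)

  -- con n evaluates to the optimised multiple of 1#, which is not the normal
  -- form of fromℕ n.
  nat : ∀ {m} → ℕ → Polynomial m
  nat zero    = con 0
  nat (suc n) = con 1 :+ nat n

  +-monoʳ-≤ : ∀ {x y} z → x ≤ y → z + x ≤ z + y
  +-monoʳ-≤ {x} {y} z x≤y = begin
    z + x  ≈⟨ +-comm z x ⟩
    x + z  ≤⟨ +-monoˡ-≤ z x≤y ⟩
    y + z  ≈⟨ +-comm y z ⟩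
    z + y  ∎

  +-mono-≤ : ∀ {x y u v} → x ≤ y → u ≤ v → x + u ≤ y + v
  +-mono-≤ {u = u} x≤y u≤v = ≤-trans (+-monoˡ-≤ u x≤y) (+-monoʳ-≤ _ u≤v)

  x≤x+y : ∀ {x y} → 0# ≤ y → x ≤ x + y
  x≤x+y {x} 0≤y = ≤-respˡ-≈ (+-identityʳ x) (+-monoʳ-≤ x 0≤y)

  x≤y+x : ∀ {x y} → 0# ≤ y → x ≤ y + x
  x≤y+x {x} 0≤y = ≤-respˡ-≈ (+-identityˡ x) (+-monoˡ-≤ x 0≤y)

  +-nonNeg : ∀ {x y} → 0# ≤ x → 0# ≤ y → 0# ≤ x + y
  +-nonNeg 0≤x 0≤y = ≤-trans 0≤x (x≤x+y 0≤y)

  x+y-y≈x : ∀ x y → (x + y) - y ≈ x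
  x+y-y≈x x y = trans (+-assoc x y (- y)) (trans (+-congˡ (-‿inverseʳ y)) (+-identityʳ x))

  x-y+y≈x : ∀ x y → (x - y) + y ≈ x
  x-y+y≈x x y = trans (+-assoc x (- y) y) (trans (+-congˡ (-‿inverseˡ y)) (+-identityʳ x))

  x≤y⇒0≤y-x : ∀ {x y} → x ≤ y → 0# ≤ y - x
  x≤y⇒0≤y-x {x} x≤y = ≤-respˡ-≈ (-‿inverseʳ x) (+-monoˡ-≤ (- x) x≤y)

  x+y≤z⇒x≤z-y : ∀ {x y z} → x + y ≤ z → x ≤ z - y
  x+y≤z⇒x≤z-y {x} {y} le = ≤-respˡ-≈ (x+y-y≈x x y) (+-monoˡ-≤ (- y) le)

  x≤x-y⇒y≤0 : ∀ {x y} → x ≤ x - y → y ≤ 0#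
  x≤x-y⇒y≤0 {x} {y} x≤x-y = begin
    y                  ≈⟨ x+y-y≈x y x ⟨
    (y + x) - x        ≈⟨ +-congʳ (+-comm y x) ⟩
    (x + y) - x        ≤⟨ +-monoˡ-≤ (- x) (+-monoˡ-≤ y x≤x-y) ⟩
    ((x - y) + y) - x  ≈⟨ +-congʳ (x-y+y≈x x y) ⟩
    x - x              ≈⟨ -‿inverseʳ x ⟩
    0#                 ∎

  *-monoˡ-≤ : ∀ {x y} z → 0# ≤ z → x ≤ y → z * x ≤ z * y
  *-monoˡ-≤ {x} {y} z 0≤z x≤y = begin
    z * x                ≤⟨ x≤y+x (*-nonNeg 0≤z (x≤y⇒0≤y-x x≤y)) ⟩
    z * (y - x) + z * x  ≈⟨ distribˡ z (y - x) x ⟨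
    z * ((y - x) + x)    ≈⟨ *-congˡ (x-y+y≈x y x) ⟩
    z * y                ∎

  *-monoʳ-≤ : ∀ {x y} z → 0# ≤ z → x ≤ y → x * z ≤ y * z
  *-monoʳ-≤ {x} {y} z 0≤z x≤y = begin
    x * z  ≈⟨ *-comm x z ⟩
    z * x  ≤⟨ *-monoˡ-≤ z 0≤z x≤y ⟩
    z * y  ≈⟨ *-comm z y ⟩
    y * z  ∎

  0≤1 : 0# ≤ 1#
  0≤1 with total 0# 1#
  ... | inj₁ 0≤1 = 0≤1
  ... | inj₂ 1≤0 = begin
    0#               ≤⟨ *-nonNeg 0≤-1 0≤-1 ⟩
    - 1# * - 1#      ≈⟨ -‿distribˡ-* 1# (- 1#) ⟨
    - (1# * - 1#)    ≈⟨ -‿cong (*-identityˡ (- 1#)) ⟩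
    - (- 1#)         ≈⟨ -‿involutive 1# ⟩
    1#               ∎
    where
    0≤-1 : 0# ≤ - 1#
    0≤-1 = ≤-respʳ-≈ (+-identityˡ (- 1#)) (x≤y⇒0≤y-x 1≤0)

  fromℕ-nonNeg : ∀ n → 0# ≤ fromℕ n
  fromℕ-nonNeg zero    = ≤-refl
  fromℕ-nonNeg (suc n) = +-nonNeg 0≤1 (fromℕ-nonNeg n)

  <-≤-trans : ∀ {x y z} → x < y → y ≤ z → x < z
  <-≤-trans (x≤y , x≉y) y≤z =
    ≤-trans x≤y y≤z , λ x≈z → x≉y (antisym x≤y (≤-respʳ-≈ (sym x≈z) y≤z))

  <⇒≱ : ∀ {x y} → x < y → ¬ (y ≤ x)
  <⇒≱ (x≤y , x≉y) y≤x = x≉y (antisym x≤y y≤x)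

  -- `P` selects the entries that count: in a table of distances the zeros on the diagonal must be
  -- left out. If nothing is selected, the bound is the default `1#`.
  positiveLowerBound : ∀ {n} {P : Fin n → Set} → (∀ i → Dec (P i)) →
    (g : Fin n → ℝ) → (∀ i → P i → 0# < g i) →
    ∃[ e ] (0# < e × (∀ i → P i → e ≤ g i))
  positiveLowerBound {zero}  P? g 0<g = 1# , (0≤1 , 0≉1) , λ ()
  positiveLowerBound {suc n} P? g 0<g
    with e , 0<e , e≤g ← positiveLowerBound (λ i → P? (Fin.suc i)) (λ i → g (Fin.suc i)) (λ i → 0<g (Fin.suc i))
    with P? Fin.zero
  ... | no ¬p = e , 0<e , λ { Fin.zero p → contradiction p ¬p ; (Fin.suc i) → e≤g i }
  ... | yes p with total e (g Fin.zero)
  ...   | inj₁ e≤g₀ = e , 0<e , λ { Fin.zero _ → e≤g₀ ; (Fin.suc i) → e≤g i }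
  ...   | inj₂ g₀≤e = g Fin.zero , 0<g Fin.zero p ,
                      λ { Fin.zero _ → ≤-refl ; (Fin.suc i) q → ≤-trans g₀≤e (e≤g i q) }

  -- If x bounds s, so does the supremum of s minus the fixed increment.
  unbounded : ExcludedMiddle 0ℓ → (s : ℕ → ℝ) {e : ℝ} → 0# < e →
    (∀ j → s j + e ≤ s (suc j)) → ∀ x → ∃[ j ] (x ≤ s j)
  unbounded em s {e} 0<e step x with em {∃[ j ] (x ≤ s j)}
  ... | yes bound = bound
  ... | no ¬bound = contradiction (x≤x-y⇒y≤0 (least b-e-bound)) (<⇒≱ 0<e)
    where
    Values : Pred ℝ 0ℓ
    Values y = ∃[ j ] (y ≡ s j)

    x-bound : x ∈ UpperBound Values
    x-bound (j , ≡.refl) with total x (s j)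
    ... | inj₁ x≤s = contradiction (j , x≤s) ¬bound
    ... | inj₂ s≤x = s≤x

    supremum = complete Values (s 0 , 0 , ≡.refl) (x , x-bound)
    b = proj₁ supremum

    least : ∀ {y} → y ∈ UpperBound Values → b ≤ y
    least = proj₂ (proj₂ supremum)

    b-e-bound : (b - e) ∈ UpperBound Values
    b-e-bound (j , ≡.refl) =
      x+y≤z⇒x≤z-y (≤-trans (step j) (proj₁ (proj₂ supremum) (suc j , ≡.refl)))

-- Concatenation and reversal of walks.

module _ {V : Set} {Adj : Rel V 0ℓ} where

  infixr 5 _++_

  _++_ : ∀ {u v w} → Walk Adj u v → Walk Adj v w → Walk Adj u w
  []      ++ q = q
  (e ∷ p) ++ q = e ∷ (p ++ q)

module WalkProperties {R : Reals} (T : WeightedTree R) where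
  open Reals R
  open WeightedTree T

  totalWeight-++ : ∀ {u v w} (p : Walk Adj u v) (q : Walk Adj v w) →
    totalWeight (p ++ q) ≈ totalWeight p + totalWeight q
  totalWeight-++ []      q = sym (+-identityˡ _)
  totalWeight-++ (e ∷ p) q =
    trans (+-congˡ (totalWeight-++ p q)) (sym (+-assoc _ _ _))

  reverseWalk : ∀ {u v} (p : Walk Adj u v) →
    ∃[ q ] (totalWeight {v} {u} q ≈ totalWeight p)
  reverseWalk [] = [] , refl
  reverseWalk {u} (_∷_ {v = v} e p) with q , q≈p ← reverseWalk p =
    q ++ (adj-sym e ∷ []) ,
    (begin
      totalWeight (q ++ (adj-sym e ∷ []))  ≈⟨ totalWeight-++ q _ ⟩
      totalWeight q + (weight v u + 0#)    ≈⟨ +-cong q≈p (+-identityʳ _) ⟩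
      totalWeight p + weight v u           ≈⟨ +-comm _ _ ⟩
      weight v u + totalWeight p           ≈⟨ +-congʳ (weight-sym e) ⟨
      weight u v + totalWeight p           ∎)
    where open import Relation.Binary.Reasoning.Setoid setoid

-- Rooted trees from an index-decreasing parent function.

module RootedTree (R : Reals) {V : Set} (finite : Finite V) (nonempty : V)
  (index : V → ℕ) (index-injective : ∀ {u v} → index u ≡ index v → u ≡ v)
  (parent : V → V) (parent-< : ∀ {u v} → index u ℕ.< index v → index (parent v) ℕ.< index v)
  (weight : V → V → Reals.ℝ R)
  (weight-sym : ∀ u v → Reals._≈_ R (weight u v) (weight v u))
  (weight-nonNeg : ∀ u v → Reals._≤_ R (Reals.0# R) (weight u v))
  where

  open Reals R hiding (zero)
  open RealProperties R

  -- The strict inequality discards the value of `parent` at the vertex of least index, so the root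
  -- needs no case of its own.
  ChildOf : Rel V 0ℓ
  ChildOf u v = index v ℕ.< index u × parent u ≡ v

  Adj : Rel V 0ℓ
  Adj u v = ChildOf u v ⊎ ChildOf v u

  loopless : ∀ {u} → ¬ Adj u u
  loopless (inj₁ (u<u , _)) = ℕ.<-irrefl ≡.refl u<u
  loopless (inj₂ (u<u , _)) = ℕ.<-irrefl ≡.refl u<u

  last∈vertices : ∀ {u v} (p : Walk Adj u v) → v ∈ˡ vertices p
  last∈vertices []      = here ≡.refl
  last∈vertices (_ ∷ p) = there (last∈vertices p)

  first∈vertices : ∀ {u v} (p : Walk Adj u v) → u ∈ˡ vertices p
  first∈vertices []      = here ≡.refl
  first∈vertices (_ ∷ p) = here ≡.refl

  -- A path never descends into a child and returns, as the parent it would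
  -- return to has been visited; so once it descends it keeps descending.
  descending-path : ∀ {a b u} (e : ChildOf b a) (p : Walk Adj b u) →
    IsPath (_∷_ {Adj = Adj} (inj₂ e) p) → index a ℕ.< index u
  descending-path (a<b , _) [] _ = a<b
  descending-path (a<b , b↑a) (inj₁ (_ , b↑c) ∷ p) (a∉ ∷ _) =
    contradiction (≡.trans (≡.sym b↑a) b↑c) (All.lookup a∉ (there (first∈vertices p)))
  descending-path (a<b , _) (inj₂ e ∷ p) (_ ∷ unique) =
    ℕ.<-trans a<b (descending-path e p unique)

  -- Either every step climbs, or some step descends. By `descending-path` all later steps then
  -- descend too, so the last one enters `u` from `parent u`.
  ascends-or-visits-parent : ∀ {a u} (p : Walk Adj a u) → IsPath p →
    index u ℕ.≤ index a ⊎ parent u ∈ˡ vertices p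
  ascends-or-visits-parent [] _ = inj₁ ℕ.≤-refl
  ascends-or-visits-parent (e ∷ p) (a∉ ∷ unique) with ascends-or-visits-parent p unique
  ... | inj₂ visited = inj₂ (there visited)
  ascends-or-visits-parent (inj₁ (b<a , _) ∷ p) _ | inj₁ u≤b =
    inj₁ (ℕ.≤-trans u≤b (ℕ.<⇒≤ b<a))
  ascends-or-visits-parent (inj₂ (_ , b↑a) ∷ []) _ | inj₁ _ = inj₂ (here b↑a)
  ascends-or-visits-parent (inj₂ (a<b , b↑a) ∷ (inj₁ (_ , b↑c) ∷ p)) (a∉ ∷ _) | inj₁ _ =
    contradiction (≡.trans (≡.sym b↑a) b↑c) (All.lookup a∉ (there (first∈vertices p)))
  ascends-or-visits-parent (inj₂ _ ∷ (inj₂ e ∷ p)) (_ ∷ unique) | inj₁ u≤b =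
    contradiction u≤b (ℕ.<⇒≱ (descending-path e p unique))

  -- The cases are whether the closing edge leads up or down and how `p` starts. Each one repeats a
  -- vertex or contradicts the order of the indices; the length condition excludes walking back
  -- along the closing edge.
  acyclic : ∀ {u v} → Adj u v → (p : Walk Adj v u) → IsPath p → ¬ (2 ℕ.≤ length p)
  acyclic _ [] _ ()
  acyclic _ (_ ∷ []) _ (ℕ.s≤s ())
  acyclic (inj₂ (_ , v↑u)) (inj₁ (_ , v↑b) ∷ (_ ∷ p)) (_ ∷ (b∉ ∷ _)) _ =
    contradiction (≡.trans (≡.sym v↑b) v↑u) (All.lookup b∉ (last∈vertices p))
  acyclic (inj₂ (u<v , _)) (inj₂ e ∷ p@(_ ∷ _)) unique _ =
    ℕ.<-asym u<v (descending-path e p unique)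
  -- The dichotomy is applied to the tail only, so that a visit to `parent u`, which is `v`, is a
  -- second visit.
  acyclic (inj₁ (v<u , u↑v)) (e ∷ p@(_ ∷ _)) (v∉ ∷ unique) _
    with ascends-or-visits-parent p unique
  ... | inj₂ visited = contradiction (≡.sym u↑v) (All.lookup v∉ visited)
  acyclic (inj₁ (v<u , u↑v)) (inj₁ (b<v , _) ∷ p) _ _ | inj₁ u≤b =
    ℕ.<-irrefl ≡.refl (ℕ.<-≤-trans v<u (ℕ.≤-trans u≤b (ℕ.<⇒≤ b<v)))
  acyclic (inj₁ _) (inj₂ (_ , b↑v) ∷ (inj₁ (_ , b↑c) ∷ p)) (v∉ ∷ _) _ | inj₁ _ =
    contradiction (≡.trans (≡.sym b↑v) b↑c) (All.lookup v∉ (there (first∈vertices p)))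
  acyclic (inj₁ _) (inj₂ _ ∷ (inj₂ e ∷ p)) (_ ∷ unique) _ | inj₁ u≤b =
    contradiction u≤b (ℕ.<⇒≱ (descending-path e p unique))

  -- The walk between u and v that repeatedly replaces the endpoint of larger
  -- index by its parent.
  data Geodesic : Rel V 0ℓ where
    stay : ∀ {u v} → u ≡ v → Geodesic u v
    fromˡ : ∀ {u v} → index v ℕ.< index u → Geodesic (parent u) v → Geodesic u v
    fromʳ : ∀ {u v} → index u ℕ.< index v → Geodesic u (parent v) → Geodesic u v

  geodesic : ∀ u v → Geodesic u v
  geodesic u v = go u v (<-wellFounded _)
    where
    go : ∀ u v → Acc ℕ._<_ (index u ℕ.+ index v) → Geodesic u v
    go u v (acc rec) with ℕ.<-cmp (index u) (index v)
    ... | tri≈ _ u≈v _ = stay (index-injective u≈v)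
    ... | tri< u<v _ _ = fromʳ u<v (go u (parent v) (rec (ℕ.+-monoʳ-< (index u) (parent-< u<v))))
    ... | tri> _ _ v<u = fromˡ v<u (go (parent u) v (rec (ℕ.+-monoˡ-< (index v) (parent-< v<u))))

  geodesicWeight : ∀ {u v} → Geodesic u v → ℝ
  geodesicWeight (stay _)          = 0#
  geodesicWeight (fromˡ {u} _ g)     = weight u (parent u) + geodesicWeight g
  geodesicWeight (fromʳ {v = v} _ g) = weight v (parent v) + geodesicWeight g

  -- The index comparisons make the three constructors mutually exclusive. This allows replacing the
  -- output of the well-founded recursion in `geodesic` by a geodesic of known shape.
  geodesicWeight-unique : ∀ {u v} (g h : Geodesic u v) → geodesicWeight g ≡ geodesicWeight h
  geodesicWeight-unique (stay _)       (stay _)       = ≡.refl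
  geodesicWeight-unique (fromˡ _ g)    (fromˡ _ h)    = ≡.cong (_ +_) (geodesicWeight-unique g h)
  geodesicWeight-unique (fromʳ _ g)    (fromʳ _ h)    = ≡.cong (_ +_) (geodesicWeight-unique g h)
  geodesicWeight-unique (stay ≡.refl)  (fromˡ u<u _)  = contradiction u<u (ℕ.<-irrefl ≡.refl)
  geodesicWeight-unique (stay ≡.refl)  (fromʳ u<u _)  = contradiction u<u (ℕ.<-irrefl ≡.refl)
  geodesicWeight-unique (fromˡ u<u _)  (stay ≡.refl)  = contradiction u<u (ℕ.<-irrefl ≡.refl)
  geodesicWeight-unique (fromʳ u<u _)  (stay ≡.refl)  = contradiction u<u (ℕ.<-irrefl ≡.refl)
  geodesicWeight-unique (fromˡ v<u _)  (fromʳ u<v _)  = contradiction u<v (ℕ.<-asym v<u)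
  geodesicWeight-unique (fromʳ u<v _)  (fromˡ v<u _)  = contradiction u<v (ℕ.<-asym v<u)

  toWalk : ∀ {u v} → Geodesic u v → Walk Adj u v
  toWalk (stay ≡.refl)  = []
  toWalk (fromˡ v<u g) = inj₁ (parent-< v<u , ≡.refl) ∷ toWalk g
  toWalk (fromʳ u<v g) = toWalk g ++ (inj₂ (parent-< u<v , ≡.refl) ∷ [])

  tree : WeightedTree R
  tree = record
    { V             = V
    ; finite        = finite
    ; nonempty      = nonempty
    ; Adj           = Adj
    ; adj-sym       = Sum.swap
    ; loopless      = loopless
    ; connected     = λ u v → toWalk (geodesic u v)
    ; acyclic       = acyclic
    ; weight        = weight
    ; weight-sym    = λ {u} {v} _ → weight-sym u v
    ; weight-nonNeg = λ {u} {v} _ → weight-nonNeg u v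
    }

  open WeightedTree tree using (totalWeight; IsShortestPathDistance)
  open WalkProperties tree

  totalWeight-toWalk : ∀ {u v} (g : Geodesic u v) → totalWeight (toWalk g) ≈ geodesicWeight g
  totalWeight-toWalk (stay ≡.refl) = refl
  totalWeight-toWalk (fromˡ _ g) = +-congˡ (totalWeight-toWalk g)
  totalWeight-toWalk {u} {v} (fromʳ u<v g) = begin-equality
    totalWeight (toWalk g ++ (_ ∷ []))                   ≈⟨ totalWeight-++ (toWalk g) _ ⟩
    totalWeight (toWalk g) + (weight (parent v) v + 0#)  ≈⟨ +-cong (totalWeight-toWalk g) (+-identityʳ _) ⟩
    geodesicWeight g + weight (parent v) v               ≈⟨ +-comm _ _ ⟩
    weight (parent v) v + geodesicWeight g               ≈⟨ +-congʳ (weight-sym (parent v) v) ⟩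
    weight v (parent v) + geodesicWeight g               ∎

  -- A bound on the absolute difference, encoded without subtraction.
  Within : ℝ → Rel ℝ 0ℓ
  Within a x y = x ≤ a + y × y ≤ a + x

  Within-+ : ∀ {a x y} b → Within a x y → Within a (b + x) (b + y)
  Within-+ {a} b (x≤ , y≤) = shift x≤ , shift y≤
    where
    shift : ∀ {x y} → x ≤ a + y → b + x ≤ a + (b + y)
    shift {x} {y} le = begin
      b + x        ≤⟨ +-monoʳ-≤ b le ⟩
      b + (a + y)  ≈⟨ solve 3 (λ a b y → b :+ (a :+ y) := a :+ (b :+ y)) refl a b y ⟩
      a + (b + y)  ∎

  within-added : ∀ {a} x → 0# ≤ a → Within a (a + x) x
  within-added x 0≤a = ≤-refl , ≤-trans (x≤y+x 0≤a) (x≤y+x 0≤a)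

  -- If `u` has the larger index, the geodesic starts with the edge to `parent u`. If `u` is `v`,
  -- the geodesic from `parent u` is that edge alone. If `v` has the larger index, it also exceeds
  -- that of `parent u`, so both geodesics move `v` to its parent and induction applies.
  geodesic-lipschitz : ∀ {u v} → index (parent u) ℕ.< index u →
    (g : Geodesic u v) (h : Geodesic (parent u) v) →
    Within (weight u (parent u)) (geodesicWeight g) (geodesicWeight h)
  geodesic-lipschitz {u} u↓ (stay ≡.refl) h
    rewrite geodesicWeight-unique h (fromʳ u↓ (stay ≡.refl)) =
    swap (within-added 0# (weight-nonNeg u (parent u)))
  geodesic-lipschitz {u} _ (fromˡ _ g) h
    rewrite geodesicWeight-unique g h =
    within-added (geodesicWeight h) (weight-nonNeg u (parent u))
  geodesic-lipschitz {u} {v} u↓ (fromʳ u<v g) h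
    rewrite geodesicWeight-unique h (fromʳ (ℕ.<-trans u↓ u<v) (geodesic (parent u) (parent v))) =
    Within-+ (weight v (parent v)) (geodesic-lipschitz u↓ g (geodesic (parent u) (parent v)))

  -- The Lipschitz bound is summed along the walk, so arbitrary walks are handled without first
  -- being reduced to paths.
  geodesic-minimal : ∀ {u v} (g : Geodesic u v) (p : Walk Adj u v) → geodesicWeight g ≤ totalWeight p
  geodesic-minimal g [] = ≤-reflexive (reflexive (geodesicWeight-unique g (stay ≡.refl)))
  geodesic-minimal {v = v} g (_∷_ {v = u′} (inj₁ (u↓ , ≡.refl)) p) =
    ≤-trans (proj₁ (geodesic-lipschitz u↓ g (geodesic u′ v)))
            (+-monoʳ-≤ _ (geodesic-minimal (geodesic u′ v) p))
  geodesic-minimal {v = v} g (_∷_ {v = u′} (inj₂ (u′↓ , ≡.refl)) p) =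
    ≤-trans (proj₂ (geodesic-lipschitz u′↓ (geodesic u′ v) g))
            (+-mono-≤ (≤-reflexive (weight-sym _ _)) (geodesic-minimal (geodesic u′ v) p))

  dist : V → V → ℝ
  dist u v = geodesicWeight (geodesic u v)

  isDist : IsShortestPathDistance dist
  isDist u v = (toWalk (geodesic u v) , totalWeight-toWalk (geodesic u v)) ,
               geodesic-minimal (geodesic u v)

-- The geometric sequence of scales.

module HierarchicalTrees (em : ExcludedMiddle 0ℓ) (R : Reals) (k : ℕ) (M : MetricSpace R)
  (finite : Finite (MetricSpace.X M)) (f : Reals.ℝ⁺ R → Reals.ℝ⁺ R) (isControl : IsControlFunction M k f)
  (c : Reals.ℝ R) (0≤c : Reals._≤_ R (Reals.0# R) c)
  (f-linear : ∀ x → Reals._≤_ R (proj₁ (f x)) (Reals._*_ R c (proj₁ x)))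
  (base : MetricSpace.X M)
  where

  open Reals R hiding (zero)
  open RealProperties R
  open MetricSpace M
  open IsGeneralMetric isMetric using (triangle; 0⇒≈; ≈⇒0; nonNegative) renaming (sym to δ-sym)
  open IsControlFunction isControl using (control)

  size = proj₁ finite
  open Inverse (proj₂ finite) using (to; from; strictlyInverseʳ)
  open Injection (↔⇒↣ (proj₂ finite)) using () renaming (injective to to-injective)
  open Injection (↔⇒↣ (↔-sym (proj₂ finite))) using () renaming (injective to from-injective)

  index : X → ℕ
  index x = toℕ (to x)

  index-injective : ∀ {x y} → index x ≡ index y → x ≡ y
  index-injective eq = to-injective (toℕ-injective eq)

  _≟_ : (x y : X) → Dec (x ≡ y)
  x ≟ y = em

  0<δ : ∀ {x y} → x ≢ y → 0# < δ x y
  0<δ x≢y = nonNegative , λ 0≈δ → x≢y (0⇒≈ (sym 0≈δ))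

  δ-refl : ∀ x → δ x x ≈ 0#
  δ-refl x = ≈⇒0 ≡.refl

  least : (P : Pred X 0ℓ) → ∀ {x} → P x → ∃[ y ] (P y × (∀ {z} → P z → index y ℕ.≤ index z))
  least P {x} Px = go x Px (<-wellFounded (index x))
    where
    go : ∀ x → P x → Acc ℕ._<_ (index x) → ∃[ y ] (P y × (∀ {z} → P z → index y ℕ.≤ index z))
    go x Px (acc rec) with em {∃[ z ] (P z × index z ℕ.< index x)}
    ... | yes (z , Pz , z<x) = go z Pz (rec z<x)
    ... | no ¬smaller = x , Px , λ {z} Pz → ℕ.≮⇒≥ λ z<x → ¬smaller (z , Pz , z<x)

  minimalDistance : ∃[ e ] (0# < e × (∀ {x y} → x ≢ y → e ≤ δ x y))
  minimalDistance = e , 0<e , λ {x} {y} x≢y →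
    ≡.subst₂ (λ x y → e ≤ δ x y) (strictlyInverseʳ x) (strictlyInverseʳ y)
      (≤-trans (e≤row (to x) tt)
        (proj₂ (proj₂ (row (to x))) (to y)
          (λ eq → x≢y (to-injective (from-injective eq)))))
    where
    row : (i : Fin size) → ∃[ e ] (0# < e × (∀ j → from i ≢ from j → e ≤ δ (from i) (from j)))
    row i = positiveLowerBound (λ j → em) (λ j → δ (from i) (from j)) (λ j → 0<δ)

    bound = positiveLowerBound {P = λ _ → ⊤} (λ _ → yes tt) (λ i → proj₁ (row i)) (λ i _ → proj₁ (proj₂ (row i)))
    e = proj₁ bound
    0<e = proj₁ (proj₂ bound)
    e≤row = proj₂ (proj₂ bound)

  ρ : ℝ
  ρ = fromℕ 3 * c + fromℕ 4

  0≤3c : 0# ≤ fromℕ 3 * c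
  0≤3c = *-nonNeg (fromℕ-nonNeg 3) 0≤c

  0≤ρ : 0# ≤ ρ
  0≤ρ = +-nonNeg 0≤3c (fromℕ-nonNeg 4)

  scale : ℕ → ℝ
  scale zero    = proj₁ minimalDistance
  scale (suc j) = ρ * scale j

  scale-nonNeg : ∀ j → 0# ≤ scale j
  scale-nonNeg zero    = proj₁ (proj₁ (proj₂ minimalDistance))
  scale-nonNeg (suc j) = *-nonNeg 0≤ρ (scale-nonNeg j)

  triple-scale : ∀ j → fromℕ 3 * scale j ≤ scale (suc j)
  triple-scale j = *-monoʳ-≤ (scale j) (scale-nonNeg j)
    (≤-trans (x≤y+x 0≤1) (x≤y+x 0≤3c))

  r≤3r : ∀ {r} → 0# ≤ r → r ≤ fromℕ 3 * r
  r≤3r {r} 0≤r = begin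
    r            ≤⟨ x≤x+y (+-nonNeg 0≤r 0≤r) ⟩
    r + (r + r)  ≈⟨ solve 1 (λ r → r :+ (r :+ r) := nat 3 :* r) refl r ⟩
    fromℕ 3 * r  ∎

  scale-mono : ∀ j → scale j ≤ scale (suc j)
  scale-mono j = ≤-trans (r≤3r (scale-nonNeg j)) (triple-scale j)

  scale₀≤scale : ∀ j → scale 0 ≤ scale j
  scale₀≤scale zero    = ≤-refl
  scale₀≤scale (suc j) = ≤-trans (scale₀≤scale j) (scale-mono j)

  -- Tripling adds at least `scale 0` at every level, which is the fixed increment that `unbounded`
  -- asks for.
  scale-unbounded : ∀ d → ∃[ j ] (d ≤ scale j)
  scale-unbounded = unbounded em scale (proj₁ (proj₂ minimalDistance)) λ j → begin
    scale j + scale 0              ≤⟨ +-monoʳ-≤ (scale j) (scale₀≤scale j) ⟩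
    scale j + scale j              ≤⟨ +-monoʳ-≤ (scale j) (x≤x+y (scale-nonNeg j)) ⟩
    scale j + (scale j + scale j)  ≈⟨ solve 1 (λ r → r :+ (r :+ r) := nat 3 :* r) refl (scale j) ⟩
    fromℕ 3 * scale j              ≤⟨ triple-scale j ⟩
    scale (suc j)                  ∎

  scale-bracket : ∀ {d} → scale 0 ≤ d → ∃[ j ] (scale j ≤ d × d ≤ scale (suc j))
  scale-bracket {d} s₀≤d = go (proj₁ (scale-unbounded d)) (proj₂ (scale-unbounded d))
    where
    go : ∀ J → d ≤ scale J → ∃[ j ] (scale j ≤ d × d ≤ scale (suc j))
    -- Here `d` coincides with `scale 0`, so the lowest bracket contains it.
    go zero    d≤s = 0 , s₀≤d , ≤-trans d≤s (scale-mono 0)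
    go (suc J) d≤s with total (scale J) d
    ... | inj₁ s≤d = J , s≤d , d≤s
    ... | inj₂ d≤s′ = go J d≤s′

  radius : ℕ → ℝ⁺
  radius j = fromℕ 3 * scale j ,
    <-≤-trans (proj₁ (proj₂ minimalDistance))
              (≤-trans (scale₀≤scale j) (r≤3r (scale-nonNeg j)))

  -- The nested partitions of one colour.

  module Colour (i : Fin (suc k)) where

    U : ℕ → Pred X 0ℓ
    U j = proj₁ (control (radius j)) i

    Near : ℕ → Rel X 0ℓ
    Near j x u = u ∈ U j × δ x u ≤ scale j

    -- The clusters at level j are the scale-j neighbourhoods of the components
    -- of U j.
    SameCluster : ℕ → Rel X 0ℓ
    SameCluster j x y = ∃[ u ] ∃[ v ] (Near j x u × Connected M (U j) (fromℕ 3 * scale j) u v × Near j y v)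

    -- Only one passage through a cluster is allowed, rather than a transitive closure, so that
    -- diameters can be read off. Transitivity is recovered in `linked-trans`.
    Linked : ℕ → Rel X 0ℓ
    Linked zero    x y = x ≡ y
    Linked (suc j) x y = Linked j x y ⊎
      ∃[ a ] ∃[ b ] (Linked j x a × SameCluster (suc j) a b × Linked j b y)

    cluster-sym : ∀ j {x y} → SameCluster j x y → SameCluster j y x
    cluster-sym j (u , v , x~u , u~v , y~v) =
      v , u , y~v , reverse (λ (a∈ , b∈ , le) → b∈ , a∈ , ≤-respˡ-≈ (δ-sym _ _) le) u~v , x~u

    cluster-diameter : ∀ j {x y} → SameCluster j x y →
      δ x y ≤ scale j + (c * (fromℕ 3 * scale j) + scale j)
    cluster-diameter j {x} {y} (u , v , (u∈ , xu) , u~v , (v∈ , yv)) = begin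
      δ x y                    ≤⟨ triangle _ _ _ ⟩
      δ x u + δ u y            ≤⟨ +-monoʳ-≤ _ (triangle _ _ _) ⟩
      δ x u + (δ u v + δ v y)  ≤⟨ +-mono-≤ xu (+-mono-≤ uv (≤-respˡ-≈ (δ-sym _ _) yv)) ⟩
      _                        ∎
      where
      uv : δ u v ≤ c * (fromℕ 3 * scale j)
      uv = ≤-trans (proj₂ (proj₂ (control (radius j))) i u u∈ (u∈ , ε) (v∈ , u~v))
                   (f-linear (radius j))

    -- The points `v` and `u′` of the two components are at most three scales apart, via `y` and
    -- `y′`. This is one step at the control radius, so the components coincide; hence the factor 3
    -- in `radius`.
    cluster-merge : ∀ j {x y y′ z} → SameCluster j x y → δ y y′ ≤ scale j →
      SameCluster j y′ z → SameCluster j x z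
    cluster-merge j {y = y} {y′} (u , v , x~u , u~v , (v∈ , yv)) yy′ (u′ , v′ , (u′∈ , yu′) , u′~v′ , z~v′) =
      u , v′ , x~u , u~v ◅◅ ((v∈ , u′∈ , gap) ◅ u′~v′) , z~v′
      where
      gap : δ v u′ ≤ fromℕ 3 * scale j
      gap = begin
        δ v u′                         ≤⟨ triangle _ _ _ ⟩
        δ v y + δ y u′                 ≤⟨ +-monoʳ-≤ _ (triangle _ _ _) ⟩
        δ v y + (δ y y′ + δ y′ u′)     ≤⟨ +-mono-≤ (≤-respˡ-≈ (δ-sym _ _) yv) (+-mono-≤ yy′ yu′) ⟩
        scale j + (scale j + scale j)  ≈⟨ solve 1 (λ r → r :+ (r :+ r) := nat 3 :* r) refl (scale j) ⟩
        fromℕ 3 * scale j              ∎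

    -- The bound is the scale one level up. That is the gap `cluster-merge` tolerates at the next
    -- level, and the sum of the three legs there is what fixes `ρ`.
    linked-diameter : ∀ j {x y} → Linked j x y → δ x y ≤ scale (suc j)
    linked-diameter zero    {x} ≡.refl = ≤-respˡ-≈ (sym (δ-refl x)) (scale-nonNeg 1)
    linked-diameter (suc j) (inj₁ x~y) = ≤-trans (linked-diameter j x~y) (scale-mono (suc j))
    linked-diameter (suc j) {x} {y} (inj₂ (a , b , x~a , ab , b~y)) = begin
      δ x y                    ≤⟨ triangle _ _ _ ⟩
      δ x a + δ a y            ≤⟨ +-monoʳ-≤ _ (triangle _ _ _) ⟩
      δ x a + (δ a b + δ b y)  ≤⟨ +-mono-≤ (linked-diameter j x~a)
                                    (+-mono-≤ (cluster-diameter (suc j) ab) (linked-diameter j b~y)) ⟩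
      r + ((r + (c * (fromℕ 3 * r) + r)) + r)
                               ≈⟨ solve 2 (λ c r → r :+ ((r :+ (c :* (nat 3 :* r) :+ r)) :+ r)
                                           := (nat 3 :* c :+ nat 4) :* r) refl c r ⟩
      ρ * r                    ∎
      where r = scale (suc j)

    linked-refl : ∀ j {x} → Linked j x x
    linked-refl zero    = ≡.refl
    linked-refl (suc j) = inj₁ (linked-refl j)

    linked-sym : ∀ j {x y} → Linked j x y → Linked j y x
    linked-sym zero    x~y = ≡.sym x~y
    linked-sym (suc j) (inj₁ x~y) = inj₁ (linked-sym j x~y)
    linked-sym (suc j) (inj₂ (a , b , x~a , ab , b~y)) =
      inj₂ (b , a , linked-sym j b~y , cluster-sym (suc j) ab , linked-sym j x~a)

    linked-trans : ∀ j {x y z} → Linked j x y → Linked j y z → Linked j x z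
    linked-trans zero    x~y y~z = ≡.trans x~y y~z
    linked-trans (suc j) (inj₁ x~y) (inj₁ y~z) = inj₁ (linked-trans j x~y y~z)
    linked-trans (suc j) (inj₁ x~y) (inj₂ (a , b , y~a , ab , b~z)) =
      inj₂ (a , b , linked-trans j x~y y~a , ab , b~z)
    linked-trans (suc j) (inj₂ (a , b , x~a , ab , b~y)) (inj₁ y~z) =
      inj₂ (a , b , x~a , ab , linked-trans j b~y y~z)
    -- The points `b` and `a′` share a class of level `j`, which is too small to meet two different
    -- clusters of level `suc j`.
    linked-trans (suc j) (inj₂ (a , b , x~a , ab , b~y)) (inj₂ (a′ , b′ , y~a′ , a′b′ , b′~z)) =
      inj₂ (a , b′ , x~a , cluster-merge (suc j) ab (linked-diameter j (linked-trans j b~y y~a′)) a′b′ , b′~z)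

    -- The centres of the classes and the tree joining them.

    -- Unfolding the search for the centre makes unification infeasible.
    abstract
      centre : ℕ → X → X
      centre j x = proj₁ (least (Linked j x) (linked-refl j))

      linked-centre : ∀ j x → Linked j x (centre j x)
      linked-centre j x = proj₁ (proj₂ (least (Linked j x) (linked-refl j)))

      centre-least : ∀ j {x y} → Linked j x y → index (centre j x) ℕ.≤ index y
      centre-least j {x} = proj₂ (proj₂ (least (Linked j x) (linked-refl j)))

    centre-cong : ∀ j {x y} → Linked j x y → centre j x ≡ centre j y
    centre-cong j {x} {y} x~y = index-injective (ℕ.≤-antisym
      (centre-least j (linked-trans j x~y (linked-centre j y)))
      (centre-least j (linked-trans j (linked-sym j x~y) (linked-centre j x))))

    -- Classes grow with the level, so a point of least index in its class also has least index in
    -- the smaller class one level below.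
    centre-fixed-below : ∀ j {x} → centre (suc j) x ≡ x → centre j x ≡ x
    centre-fixed-below j {x} fixed = index-injective (ℕ.≤-antisym
      (centre-least j (linked-refl j))
      (≡.subst (λ y → index y ℕ.≤ index (centre j x)) fixed
        (centre-least (suc j) (inj₁ (linked-centre j x)))))

    centre-fixed-≤ : ∀ {i j x} → i ℕ.≤′ j → centre j x ≡ x → centre i x ≡ x
    centre-fixed-≤ (ℕ.≤′-reflexive ≡.refl) fixed = fixed
    centre-fixed-≤ (ℕ.≤′-step i≤j)         fixed = centre-fixed-≤ i≤j (centre-fixed-below _ fixed)

    LastCentred : ℕ → Pred X 0ℓ
    LastCentred j x = centre j x ≡ x × centre (suc j) x ≢ x

    -- A point is a centre on an initial segment of the levels, which has at most one end.
    lastCentred-unique : ∀ {i j x} → LastCentred i x → LastCentred j x → i ≡ j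
    lastCentred-unique {i} {j} (ci , ¬ci) (cj , ¬cj) with ℕ.<-cmp i j
    ... | tri≈ _ i≡j _ = i≡j
    ... | tri< i<j _ _ = contradiction (centre-fixed-≤ (ℕ.≤⇒≤′ i<j) cj) ¬ci
    ... | tri> _ _ j<i = contradiction (centre-fixed-≤ (ℕ.≤⇒≤′ j<i) ci) ¬cj

    root : X
    root = proj₁ (least (λ _ → ⊤) {base} tt)

    root-least : ∀ x → index root ℕ.≤ index x
    root-least x = proj₂ (proj₂ (least (λ _ → ⊤) {base} tt)) tt

    -- The default `root` serves the points that remain centres at every level. A colour need not
    -- merge everything, for instance when its sets `U j` are empty, and attaching these points to
    -- `root` turns a forest into a tree.
    parent : X → X
    parent x with em {∃[ j ] LastCentred j x}
    ... | yes (j , _) = centre (suc j) x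
    ... | no  _       = root

    parent-lastCentred : ∀ {j x} → LastCentred j x → parent x ≡ centre (suc j) x
    parent-lastCentred {j} {x} last with em {∃[ j ] LastCentred j x}
    ... | yes (i , last′) = ≡.cong (λ j → centre (suc j) x) (lastCentred-unique last′ last)
    ... | no ¬last        = contradiction (j , last) ¬last

    centre-< : ∀ j {x} → centre j x ≢ x → index (centre j x) ℕ.< index x
    centre-< j moved = ℕ.≤∧≢⇒< (centre-least j (linked-refl j)) (λ eq → moved (index-injective eq))

    parent-< : ∀ {u x} → index u ℕ.< index x → index (parent x) ℕ.< index x
    parent-< {u} {x} u<x with em {∃[ j ] LastCentred j x}
    ... | yes (j , _ , moved) = centre-< (suc j) moved
    ... | no  _               = ℕ.≤-<-trans (root-least u) u<x

    open RootedTree R finite base index index-injective parent parent-< δ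
      δ-sym (λ _ _ → nonNegative) public
      using (tree; dist; isDist; Adj)
    open WeightedTree tree using (totalWeight)
    open WalkProperties tree

    -- Distances in the tree of one colour.

    δ≤totalWeight : ∀ {u v} (p : Walk Adj u v) → δ u v ≤ totalWeight p
    δ≤totalWeight {u} [] = ≤-reflexive (δ-refl u)
    δ≤totalWeight (_ ∷ p) = ≤-trans (triangle _ _ _) (+-monoʳ-≤ _ (δ≤totalWeight p))

    δ≤dist : ∀ u v → δ u v ≤ dist u v
    δ≤dist u v with p , p≈d ← proj₁ (isDist u v) = ≤-respʳ-≈ p≈d (δ≤totalWeight p)

    centre-step : ∀ j x → centre (suc j) (centre j x) ≡ centre (suc j) x
    centre-step j x = centre-cong (suc j) (inj₁ (linked-sym j (linked-centre j x)))

    -- Twice the weight is bounded, to avoid halves: 2 W ≤ 3 rⱼ + 2 rⱼ₊₁ ≤ 3 rⱼ₊₁.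
    toCentre : ∀ j x → ∃[ p ] (totalWeight {x} {centre j x} p + totalWeight p ≤ fromℕ 3 * scale (suc j))
    toCentre zero x = ≡.subst (λ y → ∃[ p ] (totalWeight {x} {y} p + totalWeight p ≤ fromℕ 3 * scale 1))
      (linked-centre zero x)
      ([] , ≤-respˡ-≈ (sym (+-identityʳ 0#)) (*-nonNeg (fromℕ-nonNeg 3) (scale-nonNeg 1)))
    toCentre (suc j) x
      with p , p≤ ← toCentre j x
      -- The target becomes the next centre of `centre j x`, where `p` ends. Either it is the same
      -- point, or it is one tree edge away.
      rewrite ≡.sym (centre-step j x)
      with em {centre (suc j) (centre j x) ≡ centre j x}
    ... | yes fixed rewrite fixed =
      p , ≤-trans p≤ (*-monoˡ-≤ _ (fromℕ-nonNeg 3) (scale-mono (suc j)))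
    ... | no moved = p ++ (edge ∷ []) , (begin
      W + W                      ≈⟨ +-cong W≈ W≈ ⟩
      (w + d) + (w + d)          ≈⟨ solve 2 (λ w d → (w :+ d) :+ (w :+ d) := (w :+ w) :+ (d :+ d)) refl w d ⟩
      (w + w) + (d + d)          ≤⟨ +-mono-≤ (≤-trans p≤ (triple-scale (suc j))) (+-mono-≤ d≤ d≤) ⟩
      s + (s + s)                ≈⟨ solve 1 (λ r → r :+ (r :+ r) := nat 3 :* r) refl s ⟩
      fromℕ 3 * s                ∎)
      where
      y = centre j x
      s = scale (suc (suc j))
      w = totalWeight p
      d = δ y (centre (suc j) y)

      centred : LastCentred j y
      centred = ≡.sym (centre-cong j (linked-centre j x)) , moved

      edge : Adj y (centre (suc j) y)
      edge = inj₁ (centre-< (suc j) moved , parent-lastCentred centred)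

      W = totalWeight (p ++ (edge ∷ []))

      W≈ : W ≈ w + d
      W≈ = trans (totalWeight-++ p (edge ∷ [])) (+-congˡ (+-identityʳ d))

      d≤ : d ≤ s
      d≤ = linked-diameter (suc j) (linked-centre (suc j) y)

    dist-linked : ∀ j {u v} → Linked j u v → dist u v ≤ fromℕ 3 * scale (suc j)
    dist-linked j {u} {v} u~v
      with p , p≤ ← toCentre j u
      with q , q≤ ← toCentre j v
      rewrite centre-cong j u~v
      with q⁻¹ , q⁻¹≈ ← reverseWalk q = begin
        dist u v                         ≤⟨ proj₂ (isDist u v) (p ++ q⁻¹) ⟩
        totalWeight (p ++ q⁻¹)           ≈⟨ totalWeight-++ p q⁻¹ ⟩
        totalWeight p + totalWeight q⁻¹  ≈⟨ +-congˡ q⁻¹≈ ⟩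
        totalWeight p + totalWeight q    ≤⟨ mean (total (totalWeight p) (totalWeight q)) ⟩
        fromℕ 3 * scale (suc j)          ∎
      where
      -- A sum is at most twice its larger summand, and `toCentre` bounds the doubled weights.
      mean : totalWeight p ≤ totalWeight q ⊎ totalWeight q ≤ totalWeight p →
        totalWeight p + totalWeight q ≤ fromℕ 3 * scale (suc j)
      mean (inj₁ p≤q) = ≤-trans (+-monoˡ-≤ _ p≤q) q≤
      mean (inj₂ q≤p) = ≤-trans (+-monoʳ-≤ _ q≤p) p≤

    -- The point `u` lies in its own component and `v` in the neighbourhood of that component, so
    -- the chain inside `U (suc j)` can be empty.
    close⇒linked : ∀ j {u v} → u ∈ U (suc j) → δ u v ≤ scale (suc j) → Linked (suc j) u v
    close⇒linked j {u} {v} u∈ uv = inj₂ (u , v , linked-refl j ,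
      (u , u , (u∈ , ≤-respˡ-≈ (sym (δ-refl u)) (scale-nonNeg (suc j))) , ε , (u∈ , ≤-respˡ-≈ (δ-sym _ _) uv)) ,
      linked-refl j)

  -- The stretch constant and the cover.

  σ : ℝ
  σ = fromℕ 12 * (fromℕ 3 * c + fromℕ 2) ^ 2

  0≤σ*δ : ∀ u v → 0# ≤ σ * δ u v
  0≤σ*δ u v = *-nonNeg (*-nonNeg (fromℕ-nonNeg 12) (*-nonNeg 0≤D (*-nonNeg 0≤D 0≤1))) nonNegative
    where
    0≤D : 0# ≤ fromℕ 3 * c + fromℕ 2
    0≤D = +-nonNeg 0≤3c (fromℕ-nonNeg 2)

  -- Since `3c + 4` is at most `2(3c + 2)`, squaring contributes a factor 4, and 3 times 4 is the 12
  -- in `σ`.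
  3ρ²≤σ : ∀ {s d} → 0# ≤ s → s ≤ d → fromℕ 3 * (ρ * (ρ * s)) ≤ σ * d
  3ρ²≤σ {s} {d} 0≤s s≤d = begin
    fromℕ 3 * (ρ * (ρ * s))              ≤⟨ *-monoˡ-≤ _ (fromℕ-nonNeg 3) (begin
      ρ * (ρ * s)                          ≤⟨ *-monoˡ-≤ ρ 0≤ρ (≤-trans (*-monoˡ-≤ ρ 0≤ρ s≤d) (*-monoʳ-≤ d 0≤d ρ≤D+D)) ⟩
      ρ * ((D + D) * d)                    ≤⟨ *-monoʳ-≤ ((D + D) * d) (*-nonNeg (≤-trans 0≤ρ ρ≤D+D) 0≤d) ρ≤D+D ⟩
      (D + D) * ((D + D) * d)              ∎) ⟩
    fromℕ 3 * ((D + D) * ((D + D) * d))  ≈⟨ solve 2 (λ D d → nat 3 :* ((D :+ D) :* ((D :+ D) :* d))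
                                              := (nat 12 :* (D :* (D :* con 1))) :* d) refl D d ⟩
    σ * d                                ∎
    where
    D = fromℕ 3 * c + fromℕ 2
    0≤d = ≤-trans 0≤s s≤d

    ρ≤D+D : ρ ≤ D + D
    ρ≤D+D = begin
      ρ                  ≤⟨ x≤x+y 0≤3c ⟩
      ρ + fromℕ 3 * c    ≈⟨ solve 1 (λ x → (x :+ nat 4) :+ x := (x :+ nat 2) :+ (x :+ nat 2)) refl (fromℕ 3 * c) ⟩
      D + D              ∎

  treeCover : TreeCover M (suc k) σ
  treeCover = record
    { tree       = Colour.tree
    ; embed      = λ _ → ↣-id X
    ; dist       = Colour.dist
    ; isDist     = Colour.isDist
    ; dominating = Colour.δ≤dist
    ; stretch    = stretch
    }
    where
    stretch : ∀ u v → ∃[ i ] (Colour.dist i u v ≤ σ * δ u v)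
    stretch u v with u ≟ v
    ... | yes ≡.refl = Fin.zero , ≤-trans (proj₂ (Colour.isDist Fin.zero u u) []) (0≤σ*δ u u)
    ... | no u≢v
      -- The colour is one that contains `u` at level `suc j`, whose scale reaches `δ u v`. One
      -- factor `ρ` is lost in rounding the distance up to that scale, the other because
      -- `dist-linked` bounds by the scale above it.
      with j , s≤d , d≤s ← scale-bracket (proj₂ (proj₂ minimalDistance) u≢v)
      with i , u∈ ← proj₁ (proj₂ (control (radius (suc j)))) u =
      i , ≤-trans (Colour.dist-linked i (suc j) (Colour.close⇒linked i j u∈ d≤s))
                  (3ρ²≤σ (scale-nonNeg j) s≤d)

-- Trees have at least one vertex, so the empty space is covered by trees on a single extra vertex.
emptyTreeCover : ∀ (R : Reals) (M : MetricSpace R) l {σ} → ¬ MetricSpace.X M → TreeCover M l σ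
emptyTreeCover R M l ¬X = record
  { tree       = λ _ → Singleton.tree
  ; embed      = λ _ → mk↣ {to = λ _ → tt} λ {x} → contradiction x ¬X
  ; dist       = λ _ → Singleton.dist
  ; isDist     = λ _ → Singleton.isDist
  ; dominating = λ _ u → contradiction u ¬X
  ; stretch    = λ u → contradiction u ¬X
  }
  where
  open Reals R

  ⊤-finite : Finite ⊤
  ⊤-finite = 1 , ↔-sym 1↔⊤

  module Singleton = RootedTree R ⊤-finite tt (λ _ → 0) (λ _ → ≡.refl)
    (λ _ → tt) (λ 0<0 → 0<0) (λ _ _ → 0#) (λ _ _ → refl)
    (λ _ _ → RealProperties.≤-refl R)

theorem3p1 : ExcludedMiddle 0ℓ →
    (R : Reals) → let open Reals R in
    (k : ℕ) (M : MetricSpace R) → Finite (MetricSpace.X M) →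
    (f : ℝ⁺ → ℝ⁺) → IsControlFunction M k f →
    (c : ℝ) → 0# < c → (∀ (x : ℝ⁺) → proj₁ (f x) ≤ c * proj₁ x) →
    TreeCover M (suc k) (fromℕ 12 * (fromℕ 3 * c + fromℕ 2) ^ 2)
theorem3p1 em R k M finite f isControl c (0≤c , _) f-linear with em {MetricSpace.X M}
... | yes base = HierarchicalTrees.treeCover em R k M finite f isControl c 0≤c f-linear base
... | no empty = emptyTreeCover R M (suc k) empty
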